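{- Let $X$ be a finite set with $|X|\ge 2$, $f:2^X\to\mathbb{R}_{\ge0}$ a normalized monotone submodular function possessing supermodularity of conditioning with $f(x)>0$ for all $x\in X$, and $n\le|X|$ a positive integer. Let $x_1,\dots,x_n$ be produced by the pessimistic algorithm: $S_0=\emptyset$ and for $i=1,\dots,n$, $x_i\in\arg\max_{x\in X\setminus S_{i-1}}\underline f(x\mid S_{i-1})$, $S_i=S_{i-1}\cup\{x_i\}$. Then for $i\in\{1,2\}$ (with $i\le n$), $f(x_i\mid S_{i-1})=\max_{x\in X\setminus S_{i-1}}f(x\mid S_{i-1})$, and for every $3\le i\le n$, \[ f(x_i\mid S_{i-1})\ \ge\ \big(1-\min\{(i-1)\tau_2,1\}\big)\max_{x\in X\setminus S_{i-1}} f(x\mid S_{i-1}). \] That is, the factors $\alpha_i=1$ for $i\le2$ and $\alpha_i=1/(1-\min\{(i-1)\tau_2,1\})$ for $i>2$ (with $\alpha_i=\infty$ when $(i-1)\tau_2\ge1$) satisfy $\alpha_i f(x_i\mid S_{i-1})\ge\max_{x\in X\setminus S_{i-1}}f(x\mid S_{i-1})$.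
   Context: $f(x\mid A):=f(A\cup\{x\})-f(A)$, $f(x):=f(\{x\})$, $f(x\mid y):=f(x\mid\{y\})$. Pairwise lower estimate: $\underline f(x\mid S):=f(x)-\sum_{y\in S}(f(x)-f(x\mid y))$. 2-cardinality curvature: $\tau_2:=1-\min_{x\in X,\ y\in X\setminus\{x\}} f(x\mid y)/f(x)$. Supermodularity of conditioning: for all $S\subseteq X$, $A\subseteq B\subseteq X$, $C\subseteq X\setminus B$, $f(S\mid A)-f(S\mid A\cup C)\ge f(S\mid B)-f(S\mid B\cup C)$, where $f(T\mid A):=f(A\cup T)-f(A)$. -}

module Defs where

open import Algebra.Bundles using (CommutativeRing)
open import Algebra.Structures using (IsCommutativeRing)
import Algebra.Construct.NaturalChoice.Min as Min
import Algebra.Properties.Semiring.Mult as Mult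
open import Data.Bool.Base using (if_then_else_)
open import Data.Fin.Base using (Fin; zero; suc)
open import Data.Fin.Properties using (_≟_)
open import Data.Fin.Subset using (Subset; _∈_; _∉_; _⊆_; _∪_; ∁; ⊥; ⁅_⁆; Nonempty)
open import Data.Fin.Subset.Properties using (_∈?_)
open import Data.List.Base using (List; allFin; cartesianProduct; filter; foldr; map)
import Data.List.Extrema as Extrema
import Data.List.Membership.Propositional as List
open import Data.List.Membership.Propositional.Properties
  using (∈-allFin; ∈-cartesianProduct⁺; ∈-filter⁺)
open import Data.Nat.Base as ℕ using (ℕ; zero; suc; s≤s)
import Data.Nat.Properties as ℕ
open import Data.Product.Base using (∃; _×_; _,_; proj₁; proj₂)
open import Level using (Level; _⊔_) renaming (suc to lsuc)
open import Relation.Binary.Bundles using (DecTotalOrder)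
open import Relation.Binary.Core using (Rel)
import Relation.Binary.Construct.Add.Supremum.NonStrict as AddSupremum
import Relation.Binary.Construct.NonStrictToStrict as ToStrict
open import Relation.Binary.Structures using (IsDecTotalOrder)
open import Relation.Nullary.Construct.Add.Supremum using (_⁺; ⊤⁺; [_])
open import Relation.Nullary.Decidable.Core using (does; ¬?)
open import Relation.Nullary.Negation.Core using (¬_)

private
  variable
    a : Level
    A : Set a
    N : ℕ

-- Set functions take values in an arbitrary ordered field, which stands in for
-- the (classical) reals: only the ordered-field structure of ℝ is ever used.
-- The inverse is total; its value at zero is unspecified.

record OrderedField c ℓ₁ ℓ₂ : Set (lsuc (c ⊔ ℓ₁ ⊔ ℓ₂)) where
  infix  8 _⁻¹
  infix  8 -_
  infixl 7 _*_ _/_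
  infixl 6 _+_
  infix  4 _≈_ _≤_
  field
    Carrier           : Set c
    _≈_               : Rel Carrier ℓ₁
    _≤_               : Rel Carrier ℓ₂
    _+_ _*_           : Carrier → Carrier → Carrier
    -_                : Carrier → Carrier
    0# 1#             : Carrier
    _⁻¹               : Carrier → Carrier
    isCommutativeRing : IsCommutativeRing _≈_ _+_ _*_ -_ 0# 1#
    isDecTotalOrder   : IsDecTotalOrder _≈_ _≤_
    1≉0               : ¬ (1# ≈ 0#)
    *-inverseʳ        : ∀ {x} → ¬ (x ≈ 0#) → x * x ⁻¹ ≈ 1#
    +-monoʳ-≤         : ∀ x {y z} → y ≤ z → x + y ≤ x + z
    *-nonneg          : ∀ {x y} → 0# ≤ x → 0# ≤ y → 0# ≤ x * y

  commutativeRing : CommutativeRing c ℓ₁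
  commutativeRing = record { isCommutativeRing = isCommutativeRing }

  decTotalOrder : DecTotalOrder c ℓ₁ ℓ₂
  decTotalOrder = record { isDecTotalOrder = isDecTotalOrder }

  open CommutativeRing commutativeRing public using (_-_; semiring)
  open DecTotalOrder decTotalOrder public using (_≤?_; totalOrder)
  open ToStrict _≈_ _≤_ public using (_<_)
  open Min totalOrder public using (_⊓_)
  open Mult semiring public using () renaming (_×_ to _×ₙ_)

  _/_ : Carrier → Carrier → Carrier
  x / y = x * y ⁻¹

elements : Subset N → List (Fin N)
elements {N} T = filter (_∈? T) (allFin N)

∈-elements : ∀ {T : Subset N} {x} → x ∈ T → x List.∈ elements T
∈-elements {T = T} = ∈-filter⁺ (_∈? T) (∈-allFin _)

distinctPairs : ∀ N → List (Fin N × Fin N)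
distinctPairs N =
  filter (λ p → ¬? (proj₂ p ≟ proj₁ p)) (cartesianProduct (allFin N) (allFin N))

someDistinctPair : 2 ℕ.≤ N → ∃ (List._∈ distinctPairs N)
someDistinctPair (s≤s (s≤s _)) =
  (zero , suc zero) ,
  ∈-filter⁺ (λ p → ¬? (proj₂ p ≟ proj₁ p))
    (∈-cartesianProduct⁺ (∈-allFin zero) (∈-allFin (suc zero))) λ ()

module OverField {c ℓ₁ ℓ₂} (F : OrderedField c ℓ₁ ℓ₂) where
  open OrderedField F
  open Extrema totalOrder using (argmax; argmin)

  -- The default element that `argmax` and `argmin` require is taken from the
  -- list itself, so it does not affect the extremal value.

  maximum minimum : (g : A → Carrier) (xs : List A) → ∃ (List._∈ xs) → Carrier
  maximum g xs (x , _) = g (argmax g x xs)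
  minimum g xs (x , _) = g (argmin g x xs)

  max[_] : (T : Subset N) → Nonempty T → (Fin N → Carrier) → Carrier
  max[ T ] (x , x∈T) g = maximum g (elements T) (x , ∈-elements x∈T)

  sum[_] : Subset N → (Fin N → Carrier) → Carrier
  sum[ T ] g = foldr _+_ 0# (map g (elements T))

  _∈argmax[_]_ : Fin N → Subset N → (Fin N → Carrier) → Set ℓ₂
  x ∈argmax[ T ] g = x ∈ T × (∀ y → y ∈ T → g y ≤ g x)

  -- Multiplication of an element of F ∪ {∞} by a value in F, where ∞ · v = ∞
  -- for every v ≥ 0, including v = 0: an approximation factor of ∞ carries no
  -- information.

  _·⁺_ : Carrier ⁺ → Carrier → Carrier ⁺
  [ a ] ·⁺ v = [ a * v ]
  ⊤⁺    ·⁺ v = ⊤⁺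

  open AddSupremum _≤_ public using (_≤⁺_)

  module SetFunction {N} (f : Subset N → Carrier) where

    f⟨_∣_⟩ : Subset N → Subset N → Carrier
    f⟨ T ∣ A ⟩ = f (A ∪ T) - f A

    Nonnegative : Set ℓ₂
    Nonnegative = ∀ S → 0# ≤ f S

    Normalized : Set ℓ₁
    Normalized = f ⊥ ≈ 0#

    Monotone : Set ℓ₂
    Monotone = ∀ A B → A ⊆ B → f A ≤ f B

    Submodular : Set ℓ₂
    Submodular = ∀ A B x → A ⊆ B → x ∉ B → f⟨ ⁅ x ⁆ ∣ B ⟩ ≤ f⟨ ⁅ x ⁆ ∣ A ⟩

    SupermodularityOfConditioning : Set ℓ₂
    SupermodularityOfConditioning = ∀ S A B C → A ⊆ B → C ⊆ ∁ B →
      f⟨ S ∣ B ⟩ - f⟨ S ∣ B ∪ C ⟩ ≤ f⟨ S ∣ A ⟩ - f⟨ S ∣ A ∪ C ⟩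

    lowerEstimate : Fin N → Subset N → Carrier
    lowerEstimate x S = f ⁅ x ⁆ - sum[ S ] (λ y → f ⁅ x ⁆ - f⟨ ⁅ x ⁆ ∣ ⁅ y ⁆ ⟩)

    τ₂ : 2 ℕ.≤ N → Carrier
    τ₂ 2≤N = 1# - minimum (λ (x , y) → f⟨ ⁅ x ⁆ ∣ ⁅ y ⁆ ⟩ / f ⁅ x ⁆)
                          (distinctPairs N) (someDistinctPair 2≤N)

    -- A sequence x₁, x₂, … is indexed from 1: the value x 0 is never used.

    selected : (ℕ → Fin N) → ℕ → Subset N
    selected x zero    = ⊥
    selected x (suc k) = selected x k ∪ ⁅ x (suc k) ⁆

    PessimisticRun : (ℕ → Fin N) → ℕ → Set ℓ₂
    PessimisticRun x n = ∀ k → k ℕ.< n →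
      x (suc k) ∈argmax[ ∁ (selected x k) ] λ y → lowerEstimate y (selected x k)

    remaining : ∀ {x n} → PessimisticRun x n →
                ∀ {k} → k ℕ.< n → Nonempty (∁ (selected x k))
    remaining {x} run {k} k<n = x (suc k) , proj₁ (run k k<n)

    α : 2 ℕ.≤ N → ℕ → Carrier ⁺
    α 2≤N i =
      if does (i ℕ.≤? 2)  then [ 1# ] else
      if does (1# ≤? r)   then ⊤⁺     else
                               [ 1# / (1# - (r ⊓ 1#)) ]
      where r = (i ℕ.∸ 1) ×ₙ τ₂ 2≤N

{-# OPTIONS --safe #-}
module Submission where

-- Telescoping f(x) - f(x | S) along the elements of S, supermodularity of
-- conditioning bounds each difference by the pairwise loss f(x) - f(x | y), so
-- the lower estimate never exceeds the true gain; for |S| ≤ 1 the two agree.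
-- Each pairwise loss is at most τ₂ f(x), so the lower estimate is at least
-- (1 - |S| τ₂) f(x), and submodularity gives f(x | S) ≤ f(x).  Hence if z has the
-- best gain, f(xᵢ | S) ≥ lowerEstimate z S ≥ (1 - |S| τ₂) f(z | S) whenever
-- |S| τ₂ ≤ 1.

open import Defs
open import Algebra.Bundles using (CommutativeRing)
import Algebra.Construct.NaturalChoice.Min as Min
import Algebra.Properties.Ring as RingProperties
import Algebra.Properties.Semiring.Mult as MultProperties
open import Data.Empty using (⊥-elim)
open import Data.Fin.Base using (Fin)
open import Data.Fin.Properties using (_≟_)
open import Data.Fin.Subset using (Subset; _∈_; _∉_; _∪_; ∁; ⊥; ⁅_⁆; Nonempty)
open import Data.Fin.Subset.Properties
  using (_∈?_; ∉⊥; ⊥⊆; x∈⁅x⁆; x∈⁅y⁆⇒x≡y; x∈p∪q⁻; x∈p∪q⁺; p⊆p∪q; x∈∁p⇒x∉p; x∉p⇒x∈∁p;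
         ∪-identityˡ)
open import Data.List.Base using ([]; _∷_; allFin; filter)
import Data.List.Extrema as Extrema
import Data.List.Membership.Propositional as List
open import Data.List.Membership.Propositional.Properties
  using (∈-allFin; ∈-cartesianProduct⁺; ∈-filter⁺; ∈-filter⁻)
open import Data.List.Properties using (filter-accept; filter-reject; filter-none)
open import Data.List.Relation.Binary.Permutation.Propositional
  using (_↭_; ↭-refl; ↭-reflexive; prep; swap; ↭-trans; ↭⇒↭ₛ′)
open import Data.List.Relation.Binary.Permutation.Propositional.Properties using (map⁺)
import Data.List.Relation.Binary.Permutation.Setoid.Properties as Permutation
open import Data.List.Relation.Unary.All as All using (All; []; _∷_)
open import Data.List.Relation.Unary.AllPairs using (_∷_)
open import Data.List.Relation.Unary.Any using (here; there)
open import Data.List.Relation.Unary.Unique.Propositional using (Unique)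
open import Data.List.Relation.Unary.Unique.Propositional.Properties using (allFin⁺)
open import Data.Nat.Base as ℕ using (ℕ; zero; suc; s≤s; z≤n)
import Data.Nat.Properties as ℕ
open import Data.Product.Base using (_×_; _,_; proj₁; proj₂; ∃-syntax)
open import Data.Sum.Base using (inj₁; inj₂)
open import Function.Base using (_∘_)
open import Relation.Binary.Bundles using (DecTotalOrder)
import Relation.Binary.Construct.Add.Supremum.NonStrict as AddSupremum
import Relation.Binary.Reasoning.PartialOrder as ≤-Reasoning
open import Relation.Binary.PropositionalEquality as ≡ using (_≡_; _≢_)
open import Relation.Nullary.Construct.Add.Supremum using ([_])
open import Relation.Nullary.Decidable.Core using (yes; no; ¬?)
open import Relation.Nullary.Negation.Core using (¬_)

-- Enumerating a subset after one insertion.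

module _ {N} {S : Subset N} {y : Fin N} where

  ∈-∪⁅⁆⁻ : ∀ {x} → x ≢ y → x ∈ S ∪ ⁅ y ⁆ → x ∈ S
  ∈-∪⁅⁆⁻ x≢y x∈ with x∈p∪q⁻ S ⁅ y ⁆ x∈
  ... | inj₁ x∈S = x∈S
  ... | inj₂ x∈y = ⊥-elim (x≢y (x∈⁅y⁆⇒x≡y y x∈y))

  filter-∪⁅⁆-∉ : ∀ {xs} → All (y ≢_) xs →
                 filter (_∈? S ∪ ⁅ y ⁆) xs ≡ filter (_∈? S) xs
  filter-∪⁅⁆-∉ {[]}     []           = ≡.refl
  filter-∪⁅⁆-∉ {x ∷ xs} (y≢x ∷ y∉xs) with x ∈? S
  ... | yes x∈S = ≡.trans (filter-accept (_∈? S ∪ ⁅ y ⁆) (p⊆p∪q ⁅ y ⁆ x∈S))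
                          (≡.cong (x ∷_) (filter-∪⁅⁆-∉ y∉xs))
  ... | no  x∉S = ≡.trans (filter-reject (_∈? S ∪ ⁅ y ⁆) (x∉S ∘ ∈-∪⁅⁆⁻ (y≢x ∘ ≡.sym)))
                          (filter-∪⁅⁆-∉ y∉xs)

  filter-∪⁅⁆-∈ : y ∉ S → ∀ {xs} → Unique xs → y List.∈ xs →
                 filter (_∈? S ∪ ⁅ y ⁆) xs ↭ y ∷ filter (_∈? S) xs
  filter-∪⁅⁆-∈ y∉S {_ ∷ xs} (y∉xs ∷ _) (here ≡.refl) = ↭-reflexive (begin
    filter (_∈? S ∪ ⁅ y ⁆) (y ∷ xs)  ≡⟨ filter-accept (_∈? S ∪ ⁅ y ⁆) (x∈p∪q⁺ (inj₂ (x∈⁅x⁆ y))) ⟩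
    y ∷ filter (_∈? S ∪ ⁅ y ⁆) xs    ≡⟨ ≡.cong (y ∷_) (filter-∪⁅⁆-∉ y∉xs) ⟩
    y ∷ filter (_∈? S) xs            ≡⟨ ≡.cong (y ∷_) (filter-reject (_∈? S) y∉S) ⟨
    y ∷ filter (_∈? S) (y ∷ xs)      ∎)
    where open ≡.≡-Reasoning
  filter-∪⁅⁆-∈ y∉S {x ∷ xs} (x∉xs ∷ xs!) (there y∈xs) with x ∈? S
  ... | yes x∈S = ↭-trans (↭-reflexive (filter-accept (_∈? S ∪ ⁅ y ⁆) (p⊆p∪q ⁅ y ⁆ x∈S)))
                 (↭-trans (prep x (filter-∪⁅⁆-∈ y∉S xs! y∈xs)) (swap x y ↭-refl))
  ... | no  x∉S = ↭-trans (↭-reflexive (filter-reject (_∈? S ∪ ⁅ y ⁆)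
                             (x∉S ∘ ∈-∪⁅⁆⁻ (All.lookup x∉xs y∈xs))))
                          (filter-∪⁅⁆-∈ y∉S xs! y∈xs)

  elements-∪⁅⁆ : y ∉ S → elements (S ∪ ⁅ y ⁆) ↭ y ∷ elements S
  elements-∪⁅⁆ y∉S = filter-∪⁅⁆-∈ y∉S (allFin⁺ N) (∈-allFin y)

elements-⊥ : ∀ {N} → elements {N} ⊥ ≡ []
elements-⊥ {N} = filter-none (_∈? ⊥) {xs = allFin N} (All.universal (λ _ → ∉⊥) _)

∈-distinctPairs : ∀ {N} {x y : Fin N} → y ≢ x → (x , y) List.∈ distinctPairs N
∈-distinctPairs = ∈-filter⁺ (λ p → ¬? (proj₂ p ≟ proj₁ p))
                    (∈-cartesianProduct⁺ (∈-allFin _) (∈-allFin _))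

-- Arithmetic in an ordered field.

module OrderedFieldProperties {c ℓ₁ ℓ₂} (F : OrderedField c ℓ₁ ℓ₂) where
  open OrderedField F public
  open CommutativeRing commutativeRing public
    using ( refl; sym; trans; reflexive; isEquivalence; setoid; ring
          ; +-cong; +-congˡ; +-congʳ; +-assoc; +-comm; +-identityˡ; +-identityʳ
          ; +-isCommutativeMonoid; -‿cong; -‿inverseʳ
          ; *-congˡ; *-congʳ; *-assoc; *-comm; *-identityˡ; *-identityʳ; zeroˡ; zeroʳ)
  open DecTotalOrder decTotalOrder public
    using (poset; total; antisym)
    renaming (refl to ≤-refl; trans to ≤-trans; reflexive to ≤-reflexive)
  open RingProperties ring public
  open MultProperties semiring public using (×-assoc-*)
  open Min totalOrder public using (x≤y⇒x⊓y≈x; x⊓y≤y)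
  open ≤-Reasoning poset

  x-y+y≈x : ∀ x y → x - y + y ≈ x
  x-y+y≈x x y = //-rightDividesˡ y x

  x-[x-y]≈y : ∀ x y → x - (x - y) ≈ y
  x-[x-y]≈y x y = begin-equality
    x - (x - y)  ≈⟨ +-congˡ (⁻¹-anti-homo‿- x y) ⟩
    x + (y - x)  ≈⟨ +-assoc x y (- x) ⟨
    x + y - x    ≈⟨ xyx⁻¹≈y x y ⟩
    y            ∎

  x-y+[y-z]≈x-z : ∀ x y z → (x - y) + (y - z) ≈ x - z
  x-y+[y-z]≈x-z x y z = begin-equality
    (x - y) + (y - z)  ≈⟨ +-assoc (x - y) y (- z) ⟨
    x - y + y - z      ≈⟨ +-congʳ (x-y+y≈x x y) ⟩
    x - z              ∎

  x-0≈x : ∀ x → x - 0# ≈ x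
  x-0≈x x = trans (+-congˡ -0#≈0#) (+-identityʳ x)

  +-monoˡ-≤ : ∀ z {x y} → x ≤ y → x + z ≤ y + z
  +-monoˡ-≤ z {x} {y} x≤y = begin
    x + z  ≈⟨ +-comm x z ⟩
    z + x  ≤⟨ +-monoʳ-≤ z x≤y ⟩
    z + y  ≈⟨ +-comm z y ⟩
    y + z  ∎

  +-mono-≤ : ∀ {x y u v} → x ≤ y → u ≤ v → x + u ≤ y + v
  +-mono-≤ x≤y u≤v = ≤-trans (+-monoˡ-≤ _ x≤y) (+-monoʳ-≤ _ u≤v)

  x-y≤z⇒x-z≤y : ∀ {x y z} → x - y ≤ z → x - z ≤ y
  x-y≤z⇒x-z≤y {x} {y} {z} x-y≤z = begin
    x - z          ≈⟨ +-congʳ (x-y+y≈x x y) ⟨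
    x - y + y - z  ≤⟨ +-monoˡ-≤ (- z) (+-monoˡ-≤ y x-y≤z) ⟩
    z + y - z      ≈⟨ xyx⁻¹≈y z y ⟩
    y              ∎

  x≤y⇒0≤y-x : ∀ {x y} → x ≤ y → 0# ≤ y - x
  x≤y⇒0≤y-x {x} {y} x≤y = begin
    0#     ≈⟨ -‿inverseʳ x ⟨
    x - x  ≤⟨ +-monoˡ-≤ (- x) x≤y ⟩
    y - x  ∎

  0≤y-x⇒x≤y : ∀ {x y} → 0# ≤ y - x → x ≤ y
  0≤y-x⇒x≤y {x} {y} 0≤y-x = begin
    x          ≈⟨ +-identityˡ x ⟨
    0# + x     ≤⟨ +-monoˡ-≤ x 0≤y-x ⟩
    y - x + x  ≈⟨ x-y+y≈x y x ⟩
    y          ∎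

  -‿anti-≤ : ∀ {x y} → x ≤ y → - y ≤ - x
  -‿anti-≤ {x} {y} x≤y = begin
    - y     ≈⟨ +-identityˡ (- y) ⟨
    0# - y  ≤⟨ x-y≤z⇒x-z≤y 0--x≤y ⟩
    - x     ∎
    where
    0--x≤y : 0# - - x ≤ y
    0--x≤y = begin
      0# - - x  ≈⟨ +-identityˡ (- - x) ⟩
      - - x     ≈⟨ -‿involutive x ⟩
      x         ≤⟨ x≤y ⟩
      y         ∎

  *-monoˡ-≤-nonNeg : ∀ {x y z} → 0# ≤ x → y ≤ z → x * y ≤ x * z
  *-monoˡ-≤-nonNeg {x} {y} {z} 0≤x y≤z = 0≤y-x⇒x≤y (begin
    0#             ≤⟨ *-nonneg 0≤x (x≤y⇒0≤y-x y≤z) ⟩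
    x * (z - y)    ≈⟨ x[y-z]≈xy-xz x z y ⟩
    x * z - x * y  ∎)

  *-monoʳ-≤-nonNeg : ∀ {x y z} → 0# ≤ x → y ≤ z → y * x ≤ z * x
  *-monoʳ-≤-nonNeg {x} {y} {z} 0≤x y≤z = begin
    y * x  ≈⟨ *-comm y x ⟩
    x * y  ≤⟨ *-monoˡ-≤-nonNeg 0≤x y≤z ⟩
    x * z  ≈⟨ *-comm x z ⟩
    z * x  ∎

  x≤0⇒0≤-x : ∀ {x} → x ≤ 0# → 0# ≤ - x
  x≤0⇒0≤-x {x} x≤0 = begin
    0#    ≈⟨ -0#≈0# ⟨
    - 0#  ≤⟨ -‿anti-≤ x≤0 ⟩
    - x   ∎

  0≤1 : 0# ≤ 1#
  0≤1 with total 0# 1#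
  ... | inj₁ 0≤1 = 0≤1
  -- Even in this case 1 is nonnegative, being the square of the nonnegative element -1.
  ... | inj₂ 1≤0 = begin
    0#           ≤⟨ *-nonneg (x≤0⇒0≤-x 1≤0) (x≤0⇒0≤-x 1≤0) ⟩
    - 1# * - 1#  ≈⟨ -1*x≈-x (- 1#) ⟩
    - - 1#       ≈⟨ -‿involutive 1# ⟩
    1#           ∎

  0<x⇒x*x⁻¹≈1 : ∀ {x} → 0# < x → x * x ⁻¹ ≈ 1#
  0<x⇒x*x⁻¹≈1 (_ , 0≉x) = *-inverseʳ (0≉x ∘ sym)

  0<x⇒0≤x⁻¹ : ∀ {x} → 0# < x → 0# ≤ x ⁻¹
  0<x⇒0≤x⁻¹ {x} 0<x with total 0# (x ⁻¹)
  ... | inj₁ 0≤x⁻¹ = 0≤x⁻¹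
  ... | inj₂ x⁻¹≤0 = ⊥-elim (1≉0 (antisym 1≤0 0≤1))
    where
    1≤0 : 1# ≤ 0#
    1≤0 = begin
      1#        ≈⟨ 0<x⇒x*x⁻¹≈1 0<x ⟨
      x * x ⁻¹  ≤⟨ *-monoˡ-≤-nonNeg (proj₁ 0<x) x⁻¹≤0 ⟩
      x * 0#    ≈⟨ zeroʳ x ⟩
      0#        ∎

  x/y*y≈x : ∀ {x y} → 0# < y → x / y * y ≈ x
  x/y*y≈x {x} {y} 0<y = begin-equality
    x * y ⁻¹ * y    ≈⟨ *-assoc x (y ⁻¹) y ⟩
    x * (y ⁻¹ * y)  ≈⟨ *-congˡ (trans (*-comm (y ⁻¹) y) (0<x⇒x*x⁻¹≈1 0<y)) ⟩
    x * 1#          ≈⟨ *-identityʳ x ⟩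
    x               ∎

  x*y≤z⇒y≤1/x*z : ∀ {x y z} → 0# < x → x * y ≤ z → y ≤ 1# / x * z
  x*y≤z⇒y≤1/x*z {x} {y} {z} 0<x x*y≤z = begin
    y                 ≈⟨ *-identityˡ y ⟨
    1# * y            ≈⟨ *-congʳ (x/y*y≈x 0<x) ⟨
    1# / x * x * y    ≈⟨ *-assoc (1# / x) x y ⟩
    1# / x * (x * y)  ≤⟨ *-monoˡ-≤-nonNeg 0≤1/x x*y≤z ⟩
    1# / x * z        ∎
    where
    0≤1/x : 0# ≤ 1# / x
    0≤1/x = *-nonneg 0≤1 (0<x⇒0≤x⁻¹ 0<x)

  x≰y⇒y≤x : ∀ {x y} → ¬ (x ≤ y) → y ≤ x
  x≰y⇒y≤x {x} {y} x≰y with total x y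
  ... | inj₁ x≤y = ⊥-elim (x≰y x≤y)
  ... | inj₂ y≤x = y≤x

  -- Makes the denominator of a finite `α` invertible. If it vanished, the truncated value, which is
  -- `x` itself here, would equal 1.
  1≰x⇒0<1-x⊓1 : ∀ {x} → ¬ (1# ≤ x) → 0# < 1# - (x ⊓ 1#)
  1≰x⇒0<1-x⊓1 {x} 1≰x = x≤y⇒0≤y-x (x⊓y≤y x 1#) , λ 0≈1-m → 1≰x (begin
    1#      ≈⟨ x∙y⁻¹≈ε⇒x≈y 1# (x ⊓ 1#) (sym 0≈1-m) ⟩
    x ⊓ 1#  ≈⟨ x≤y⇒x⊓y≈x (x≰y⇒y≤x 1≰x) ⟩
    x       ∎)

  -- Removes the truncation: beyond 1 the factor is zero and `0# ≤ z` suffices, so the real estimate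
  -- may assume `x ≤ 1#`.
  [1-x⊓1]y≤z : ∀ {x y z} → 0# ≤ z → (x ≤ 1# → (1# - x) * y ≤ z) → (1# - (x ⊓ 1#)) * y ≤ z
  -- `x ⊓ 1#` is computed from `total x 1#`, so this split evaluates it.
  [1-x⊓1]y≤z {x} {y} {z} 0≤z [1-x]y≤z with total x 1#
  ... | inj₁ x≤1 = [1-x]y≤z x≤1
  ... | inj₂ 1≤x = begin
    (1# - 1#) * y  ≈⟨ *-congʳ (-‿inverseʳ 1#) ⟩
    0# * y         ≈⟨ zeroˡ y ⟩
    0#             ≤⟨ 0≤z ⟩
    z              ∎

-- Extrema and sums over finite subsets.

module OverFieldProperties {c ℓ₁ ℓ₂} (F : OrderedField c ℓ₁ ℓ₂) where
  open OrderedFieldProperties F public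
  open OverField F public
  open Extrema totalOrder
    using (argmax; argmax-all; f[xs]≤f[argmax]; f[argmin]≤f[xs])
  open ≤-Reasoning poset

  minimum≤ : ∀ {a} {A : Set a} (g : A → Carrier) {xs} ne {x} → x List.∈ xs →
             minimum g xs ne ≤ g x
  minimum≤ g (x₀ , _) = All.lookup (f[argmin]≤f[xs] x₀ _)

  module _ {N} {T : Subset N} (ne : Nonempty T) (g : Fin N → Carrier) where

    ≤max : ∀ {x} → x ∈ T → g x ≤ max[ T ] ne g
    ≤max x∈T = All.lookup (f[xs]≤f[argmax] (proj₁ ne) (elements T)) (∈-elements x∈T)

    max-attained : ∃[ z ] z ∈ T × max[ T ] ne g ≡ g z
    max-attained =
      argmax g (proj₁ ne) (elements T) ,
      -- `argmax` may return its default, so membership in `T` is supplied for the default as well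
      -- as for the listed elements.
      argmax-all g (proj₂ ne)
        (All.tabulate (proj₂ ∘ ∈-filter⁻ (_∈? T) {xs = allFin N})) ,
      ≡.refl

  module _ {N} (g : Fin N → Carrier) where

    sum-⊥ : sum[ ⊥ ] g ≈ 0#
    sum-⊥ rewrite elements-⊥ {N} = refl

    -- A fold in a commutative monoid is invariant under permutation, so the new element can be
    -- moved to the front.
    sum-∪⁅⁆ : ∀ {S y} → y ∉ S → sum[ S ∪ ⁅ y ⁆ ] g ≈ g y + sum[ S ] g
    sum-∪⁅⁆ y∉S = Permutation.foldr-commMonoid setoid +-isCommutativeMonoid
      (↭⇒↭ₛ′ isEquivalence (map⁺ g (elements-∪⁅⁆ y∉S)))

  -- Gains, pairwise losses and the lower estimate.

  module SetFunctionProperties {N} (f : Subset N → Carrier) where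
    open SetFunction f public

    -- Definitionally the summand of `lowerEstimate`.
    pairwiseLoss : Fin N → Fin N → Carrier
    pairwiseLoss x y = f ⁅ x ⁆ - f⟨ ⁅ x ⁆ ∣ ⁅ y ⁆ ⟩

    gain-⊥ : Normalized → ∀ x → f⟨ ⁅ x ⁆ ∣ ⊥ ⟩ ≈ f ⁅ x ⁆
    gain-⊥ normalized x = begin-equality
      f (⊥ ∪ ⁅ x ⁆) - f ⊥  ≡⟨ ≡.cong (λ S → f S - f ⊥) (∪-identityˡ ⁅ x ⁆) ⟩
      f ⁅ x ⁆ - f ⊥        ≈⟨ +-congˡ (-‿cong normalized) ⟩
      f ⁅ x ⁆ - 0#         ≈⟨ x-0≈x (f ⁅ x ⁆) ⟩
      f ⁅ x ⁆              ∎

    gain≤singleton : Normalized → Submodular → ∀ {S x} → x ∉ S →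
                     f⟨ ⁅ x ⁆ ∣ S ⟩ ≤ f ⁅ x ⁆
    gain≤singleton normalized submodular {S} {x} x∉S = begin
      f⟨ ⁅ x ⁆ ∣ S ⟩  ≤⟨ submodular ⊥ S x ⊥⊆ x∉S ⟩
      f⟨ ⁅ x ⁆ ∣ ⊥ ⟩  ≈⟨ gain-⊥ normalized x ⟩
      f ⁅ x ⁆         ∎

    gain-nonNeg : Monotone → ∀ T S → 0# ≤ f⟨ T ∣ S ⟩
    gain-nonNeg monotone T S = x≤y⇒0≤y-x (monotone S (S ∪ T) (p⊆p∪q T))

    -- The minimal ratio `m` in `τ₂` bounds the ratio of this pair; multiplying by `f ⁅ x ⁆`, which
    -- is positive, clears the denominator.
    pairwiseLoss≤τ₂ : ∀ 2≤N {x y} → 0# < f ⁅ x ⁆ → y ≢ x →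
                      pairwiseLoss x y ≤ τ₂ 2≤N * f ⁅ x ⁆
    pairwiseLoss≤τ₂ 2≤N {x} {y} 0<fx y≢x = begin
      fx - fxy          ≤⟨ +-monoʳ-≤ fx (-‿anti-≤ m*fx≤fxy) ⟩
      fx - m * fx       ≈⟨ +-congʳ (*-identityˡ fx) ⟨
      1# * fx - m * fx  ≈⟨ [y-z]x≈yx-zx fx 1# m ⟨
      (1# - m) * fx     ∎
      where
      fx  = f ⁅ x ⁆
      fxy = f⟨ ⁅ x ⁆ ∣ ⁅ y ⁆ ⟩
      ratio : Fin N × Fin N → Carrier
      ratio (x , y) = f⟨ ⁅ x ⁆ ∣ ⁅ y ⁆ ⟩ / f ⁅ x ⁆
      m   = minimum ratio (distinctPairs N) (someDistinctPair 2≤N)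
      m*fx≤fxy : m * fx ≤ fxy
      m*fx≤fxy = begin
        m * fx         ≤⟨ *-monoʳ-≤-nonNeg (proj₁ 0<fx)
                            (minimum≤ ratio (someDistinctPair 2≤N) (∈-distinctPairs y≢x)) ⟩
        fxy / fx * fx  ≈⟨ x/y*y≈x 0<fx ⟩
        fxy            ∎

    -- Says that the first `k` picks are distinct, phrased step by step to suit induction along
    -- `selected`.
    RepetitionFree : (ℕ → Fin N) → ℕ → Set
    RepetitionFree x k = ∀ j → j ℕ.< k → x (suc j) ∉ selected x j

    module _ (x : ℕ → Fin N) where

      repetitionFree-pred : ∀ {k} → RepetitionFree x (suc k) → RepetitionFree x k
      repetitionFree-pred fresh j j<k = fresh j (ℕ.m<n⇒m<1+n j<k)

      -- The multiple `k ×ₙ b` stands for the cardinality of the selected set times `b`; each fresh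
      -- pick adds one summand.
      sum-selected≤ : ∀ k → RepetitionFree x k → ∀ {g b} →
                      (∀ y → y ∈ selected x k → g y ≤ b) →
                      sum[ selected x k ] g ≤ k ×ₙ b
      sum-selected≤ zero    fresh {g} g≤b = ≤-reflexive (sum-⊥ g)
      sum-selected≤ (suc k) fresh {g} {b} g≤b = begin
        sum[ S ∪ ⁅ y ⁆ ] g  ≈⟨ sum-∪⁅⁆ g (fresh k ℕ.≤-refl) ⟩
        g y + sum[ S ] g    ≤⟨ +-mono-≤ (g≤b y (x∈p∪q⁺ (inj₂ (x∈⁅x⁆ y))))
                                 (sum-selected≤ k (repetitionFree-pred fresh)
                                   (λ z z∈S → g≤b z (p⊆p∪q ⁅ y ⁆ z∈S))) ⟩
        b + k ×ₙ b          ∎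
        where
        S = selected x k
        y = x (suc k)

      -- Induction on `k` carries out the telescoping: every new pick costs `z` at most what it
      -- would cost with nothing else selected.
      loss≤sum : Normalized → SupermodularityOfConditioning →
                 ∀ k → RepetitionFree x k → ∀ z →
                 f ⁅ z ⁆ - f⟨ ⁅ z ⁆ ∣ selected x k ⟩ ≤ sum[ selected x k ] (pairwiseLoss z)
      loss≤sum normalized supermodular zero fresh z = begin
        f ⁅ z ⁆ - f⟨ ⁅ z ⁆ ∣ ⊥ ⟩   ≈⟨ +-congˡ (-‿cong (gain-⊥ normalized z)) ⟩
        f ⁅ z ⁆ - f ⁅ z ⁆          ≈⟨ -‿inverseʳ (f ⁅ z ⁆) ⟩
        0#                         ≈⟨ sum-⊥ (pairwiseLoss z) ⟨
        sum[ ⊥ ] (pairwiseLoss z)  ∎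
      loss≤sum normalized supermodular (suc k) fresh z = begin
        f ⁅ z ⁆ - f⟨ ⁅ z ⁆ ∣ S ∪ ⁅ y ⁆ ⟩
          ≈⟨ x-y+[y-z]≈x-z (f ⁅ z ⁆) f⟨ ⁅ z ⁆ ∣ S ⟩ f⟨ ⁅ z ⁆ ∣ S ∪ ⁅ y ⁆ ⟩ ⟨
        (f ⁅ z ⁆ - f⟨ ⁅ z ⁆ ∣ S ⟩) + (f⟨ ⁅ z ⁆ ∣ S ⟩ - f⟨ ⁅ z ⁆ ∣ S ∪ ⁅ y ⁆ ⟩)
          ≤⟨ +-mono-≤ (loss≤sum normalized supermodular k (repetitionFree-pred fresh) z)
                      -- The loss due to `y` on top of `S` is compared with its loss on top of the
                      -- empty set, which is the pairwise loss. Disjointness from `S` is the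
                      -- freshness of `y`.
                      (supermodular ⁅ z ⁆ ⊥ S ⁅ y ⁆ ⊥⊆ y⊆∁S) ⟩
        sum[ S ] (pairwiseLoss z) + (f⟨ ⁅ z ⁆ ∣ ⊥ ⟩ - f⟨ ⁅ z ⁆ ∣ ⊥ ∪ ⁅ y ⁆ ⟩)
          ≈⟨ +-congˡ (+-cong (gain-⊥ normalized z)
               (-‿cong (reflexive (≡.cong f⟨ ⁅ z ⁆ ∣_⟩ (∪-identityˡ ⁅ y ⁆))))) ⟩
        sum[ S ] (pairwiseLoss z) + pairwiseLoss z y
          ≈⟨ +-comm _ _ ⟩
        pairwiseLoss z y + sum[ S ] (pairwiseLoss z)
          ≈⟨ sum-∪⁅⁆ (pairwiseLoss z) y∉S ⟨
        sum[ S ∪ ⁅ y ⁆ ] (pairwiseLoss z)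
          ∎
        where
        S = selected x k
        y = x (suc k)
        y∉S = fresh k ℕ.≤-refl
        y⊆∁S : ∀ {w} → w ∈ ⁅ y ⁆ → w ∈ ∁ S
        y⊆∁S w∈y with ≡.refl ← x∈⁅y⁆⇒x≡y y w∈y = x∉p⇒x∈∁p y∉S

      lowerEstimate≤gain : Normalized → SupermodularityOfConditioning →
                           ∀ k → RepetitionFree x k → ∀ z →
                           lowerEstimate z (selected x k) ≤ f⟨ ⁅ z ⁆ ∣ selected x k ⟩
      lowerEstimate≤gain normalized supermodular k fresh z =
        x-y≤z⇒x-z≤y (loss≤sum normalized supermodular k fresh z)

      -- The sum has at most one term: it is empty, or it is a single pairwise loss, and subtracting
      -- that from `f ⁅ z ⁆` returns the conditional gain exactly.
      lowerEstimate≈gain : Normalized → ∀ k → k ℕ.≤ 1 → ∀ z →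
                           lowerEstimate z (selected x k) ≈ f⟨ ⁅ z ⁆ ∣ selected x k ⟩
      lowerEstimate≈gain normalized zero _ z = begin-equality
        f ⁅ z ⁆ - sum[ ⊥ ] (pairwiseLoss z)  ≈⟨ +-congˡ (-‿cong (sum-⊥ (pairwiseLoss z))) ⟩
        f ⁅ z ⁆ - 0#                         ≈⟨ x-0≈x (f ⁅ z ⁆) ⟩
        f ⁅ z ⁆                              ≈⟨ gain-⊥ normalized z ⟨
        f⟨ ⁅ z ⁆ ∣ ⊥ ⟩                       ∎
      lowerEstimate≈gain normalized (suc zero) _ z = begin-equality
        f ⁅ z ⁆ - sum[ ⊥ ∪ ⁅ y ⁆ ] (pairwiseLoss z)
          ≈⟨ +-congˡ (-‿cong (sum-∪⁅⁆ (pairwiseLoss z) ∉⊥)) ⟩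
        f ⁅ z ⁆ - (pairwiseLoss z y + sum[ ⊥ ] (pairwiseLoss z))
          ≈⟨ +-congˡ (-‿cong (trans (+-congˡ (sum-⊥ (pairwiseLoss z))) (+-identityʳ _))) ⟩
        f ⁅ z ⁆ - pairwiseLoss z y
          ≈⟨ x-[x-y]≈y (f ⁅ z ⁆) f⟨ ⁅ z ⁆ ∣ ⁅ y ⁆ ⟩ ⟩
        f⟨ ⁅ z ⁆ ∣ ⁅ y ⁆ ⟩
          ≡⟨ ≡.cong f⟨ ⁅ z ⁆ ∣_⟩ (∪-identityˡ ⁅ y ⁆) ⟨
        f⟨ ⁅ z ⁆ ∣ ⊥ ∪ ⁅ y ⁆ ⟩
          ∎
        where y = x 1
      lowerEstimate≈gain normalized (suc (suc _)) (s≤s ()) z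

      [1-kτ₂]singleton≤lowerEstimate :
        ∀ 2≤N k → RepetitionFree x k → ∀ {z} → 0# < f ⁅ z ⁆ → z ∉ selected x k →
        (1# - k ×ₙ τ₂ 2≤N) * f ⁅ z ⁆ ≤ lowerEstimate z (selected x k)
      [1-kτ₂]singleton≤lowerEstimate 2≤N k fresh {z} 0<fz z∉S = begin
        (1# - k ×ₙ τ) * fz       ≈⟨ [y-z]x≈yx-zx fz 1# (k ×ₙ τ) ⟩
        1# * fz - (k ×ₙ τ) * fz  ≈⟨ +-cong (*-identityˡ fz) (-‿cong (×-assoc-* k τ fz)) ⟩
        fz - k ×ₙ (τ * fz)       ≤⟨ +-monoʳ-≤ fz (-‿anti-≤ (sum-selected≤ k fresh loss≤)) ⟩
        lowerEstimate z (selected x k)  ∎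
        where
        τ  = τ₂ 2≤N
        fz = f ⁅ z ⁆
        loss≤ : ∀ y → y ∈ selected x k → pairwiseLoss z y ≤ τ * fz
        -- `τ₂` controls only pairs of distinct elements; `z` lies outside the selected set, so it
        -- differs from each `y` in it.
        loss≤ y y∈S = pairwiseLoss≤τ₂ 2≤N 0<fz λ { ≡.refl → z∉S y∈S }

-- Approximation factors of the pessimistic algorithm.

theorem5 :
  ∀ {c ℓ₁ ℓ₂} (F : OrderedField c ℓ₁ ℓ₂) (N : ℕ) (2≤N : 2 ℕ.≤ N) →
  (f : Subset N → OrderedField.Carrier F) →
  let open OrderedField F
      open OverField F
      open SetFunction f
  in
  Nonnegative → Normalized → Monotone → Submodular →
  SupermodularityOfConditioning →
  (∀ x → 0# < f ⁅ x ⁆) →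
  (n : ℕ) → 1 ℕ.≤ n → n ℕ.≤ N →
  (x : ℕ → Fin N) (run : PessimisticRun x n) →
  -- the step producing x i for i = suc k, with S i-1 = selected x k
  (k : ℕ) (k<n : k ℕ.< n) →
  let i = suc k
      S = selected x k
      gain = f⟨ ⁅ x i ⁆ ∣ S ⟩
      best = max[ ∁ S ] (remaining run k<n) (λ y → f⟨ ⁅ y ⁆ ∣ S ⟩)
  in
  (i ℕ.≤ 2 → gain ≈ best)
  × (3 ℕ.≤ i → (1# - ((k ×ₙ τ₂ 2≤N) ⊓ 1#)) * best ≤ gain)
  × ([ best ] ≤⁺ (α 2≤N i ·⁺ gain))
theorem5 F N 2≤N f _ normalized monotone submodular supermodular positive n _ _ x run k k<n =
  gain≈best , (λ _ → factor*best≤gain) , best≤α·gain k k<n gain≈best factor*best≤gain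
  where
  open OverFieldProperties F
  open SetFunctionProperties f
  open ≤-Reasoning poset

  -- Gain and maximum are kept as functions of the step, so that `best≤α·gain` can split on the
  -- index while `k` stays fixed.
  G : ∀ j → Carrier
  G j = f⟨ ⁅ x (suc j) ⁆ ∣ selected x j ⟩

  B : ∀ {j} → j ℕ.< n → Carrier
  B {j} j<n = max[ ∁ (selected x j) ] (remaining run j<n) (λ y → f⟨ ⁅ y ⁆ ∣ selected x j ⟩)

  S    = selected x k
  gain = G k
  best = B k<n
  r    = k ×ₙ τ₂ 2≤N

  fresh : RepetitionFree x k
  fresh j j<k = x∈∁p⇒x∉p (proj₁ (run j (ℕ.<-trans j<k k<n)))

  attained = max-attained (remaining run k<n) (λ y → f⟨ ⁅ y ⁆ ∣ S ⟩)
  z        = proj₁ attained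
  z∈∁S     = proj₁ (proj₂ attained)
  best≡    = proj₂ (proj₂ attained)
  z∉S      = x∈∁p⇒x∉p z∈∁S

  lower≤ : lowerEstimate z S ≤ lowerEstimate (x (suc k)) S
  lower≤ = proj₂ (run k k<n) z z∈∁S

  gain≈best : suc k ℕ.≤ 2 → gain ≈ best
  gain≈best (s≤s k≤1) =
    -- The pick is itself a candidate, which gives one inequality. For the other, maximising the
    -- estimate is maximising the gain, since the two agree here.
    antisym (≤max (remaining run k<n) (λ y → f⟨ ⁅ y ⁆ ∣ S ⟩) (proj₁ (run k k<n))) (begin
      best                        ≡⟨ best≡ ⟩
      f⟨ ⁅ z ⁆ ∣ S ⟩              ≈⟨ lowerEstimate≈gain x normalized k k≤1 z ⟨
      lowerEstimate z S           ≤⟨ lower≤ ⟩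
      lowerEstimate (x (suc k)) S ≈⟨ lowerEstimate≈gain x normalized k k≤1 (x (suc k)) ⟩
      gain                        ∎)

  factor*best≤gain : (1# - (r ⊓ 1#)) * best ≤ gain
  factor*best≤gain = [1-x⊓1]y≤z (gain-nonNeg monotone _ S) λ r≤1 → begin
    (1# - r) * best             ≡⟨ ≡.cong ((1# - r) *_) best≡ ⟩
    -- `r≤1` makes the factor nonnegative, so enlarging the gain to `f ⁅ z ⁆` preserves the
    -- inequality.
    (1# - r) * f⟨ ⁅ z ⁆ ∣ S ⟩   ≤⟨ *-monoˡ-≤-nonNeg (x≤y⇒0≤y-x r≤1)
                                     (gain≤singleton normalized submodular z∉S) ⟩
    (1# - r) * f ⁅ z ⁆          ≤⟨ [1-kτ₂]singleton≤lowerEstimate x 2≤N k fresh (positive z) z∉S ⟩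
    lowerEstimate z S           ≤⟨ lower≤ ⟩
    lowerEstimate (x (suc k)) S ≤⟨ lowerEstimate≤gain x normalized supermodular k fresh (x (suc k)) ⟩
    gain                        ∎

  best≤1*gain : ∀ {j} (j<n : j ℕ.< n) → G j ≈ B j<n → [ B j<n ] ≤⁺ [ 1# * G j ]
  best≤1*gain j<n gain≈best = AddSupremum.[ ≤-reflexive (trans (sym gain≈best) (sym (*-identityˡ _))) ]

  -- The split into 0, 1 and at least 2 decides the test `i ≤ 2` in `α`, which then reduces to 1 in
  -- the first two cases.
  best≤α·gain : ∀ j (j<n : j ℕ.< n) → (suc j ℕ.≤ 2 → G j ≈ B j<n) →
                (1# - ((j ×ₙ τ₂ 2≤N) ⊓ 1#)) * B j<n ≤ G j →
                [ B j<n ] ≤⁺ (α 2≤N (suc j) ·⁺ G j)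
  best≤α·gain zero          j<n exact _ = best≤1*gain j<n (exact (s≤s z≤n))
  best≤α·gain (suc zero)    j<n exact _ = best≤1*gain j<n (exact (s≤s (s≤s z≤n)))
  -- This is the remaining test in `α`: the factor is infinite if it succeeds, and otherwise the
  -- product bound is divided by a positive number.
  best≤α·gain (suc (suc j)) j<n _ bound with 1# ≤? (suc (suc j) ×ₙ τ₂ 2≤N)
  ... | yes _   = _ AddSupremum.≤⊤⁺
  ... | no  1≰r = AddSupremum.[ x*y≤z⇒y≤1/x*z (1≰x⇒0<1-x⊓1 1≰r) bound ]
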